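{- Let $k\geq 4$ be an integer. If for every graph $H$ with $\Delta(H)=k-1$ all proper $(\chi'(H)+1)$-edge colorings of $H$ are Kempe equivalent, then for every Class 2 graph $G$ with $\Delta(G)=k$ all proper $(k+2)$-edge colorings of $G$ are Kempe equivalent.
   Context: All graphs are finite, without loops and multiple edges. A proper $t$-edge coloring of $G$ is a map $f:E(G)\to\{1,\dots,t\}$ with $f(e)\neq f(e')$ for adjacent edges $e,e'$. $\Delta(G)$ is the maximum degree and $\chi'(G)$ the chromatic index. $G$ is Class 2 if $\chi'(G)=\Delta(G)+1$. For a proper $t$-edge coloring $f$ and colors $a,b$, $G_f(a,b)$ is the subgraph induced by the edges colored $a$ or $b$; switching colors $a$ and $b$ on one connected component of $G_f(a,b)$ is an interchange. Two proper $t$-edge colorings are Kempe equivalent if one can be obtained from the other by a sequence of interchanges. -}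

module Defs where

open import Data.Nat using (ℕ; _⊔_; _+_; _≤_)
open import Data.Fin using (Fin; _≟_)
open import Data.Fin.Properties using () 
open import Data.Bool using (Bool; true; false)
open import Data.List using (List; foldr; map; length; filter; allFin)
open import Data.Product using (_×_; Σ; _,_)
open import Data.Sum using (_⊎_)
open import Relation.Nullary using (¬_; yes; no)
open import Relation.Binary.PropositionalEquality using (_≡_; _≢_)
open import Relation.Binary.Construct.Closure.ReflexiveTransitive using (Star)

record Graph (n : ℕ) : Set where
  field
    adj     : Fin n → Fin n → Bool
    sym     : ∀ u v → adj u v ≡ adj v u
    irrefl  : ∀ v → adj v v ≡ false

open Graph public

Edge : ∀ {n} → Graph n → Fin n → Fin n → Set
Edge G u v = adj G u v ≡ true

deg : ∀ {n} → Graph n → Fin n → ℕ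
deg {n} G v = length (filter (λ w → adj G v w ≟b true) (allFin n))
  where
  open import Data.Bool.Properties using () renaming (_≟_ to _≟b_)

Δ : ∀ {n} → Graph n → ℕ
Δ {n} G = foldr _⊔_ 0 (map (deg G) (allFin n))

-- A t-edge coloring: a color in Fin t (colors 1..t) for every edge uv,
-- given as a function on ordered pairs; only values on edges matter,
-- and it must be symmetric on edges (uv and vu are the same edge).
Coloring : ℕ → ℕ → Set
Coloring n t = Fin n → Fin n → Fin t

IsProperColoring : ∀ {n t} → Graph n → Coloring n t → Set
IsProperColoring G f =
  (∀ u v → Edge G u v → f u v ≡ f v u) ×
  (∀ u v w → Edge G u v → Edge G u w → v ≢ w → f u v ≢ f u w)

Colorable : ∀ {n} → Graph n → ℕ → Set
Colorable {n} G t = Σ (Coloring n t) (IsProperColoring G)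

IsChromaticIndex : ∀ {n} → Graph n → ℕ → Set
IsChromaticIndex G χ = Colorable G χ × (∀ t → Colorable G t → χ ≤ t)

Class2 : ∀ {n} → Graph n → Set
Class2 G = IsChromaticIndex G (Δ G + 1)

swap : ∀ {t} → Fin t → Fin t → Fin t → Fin t
swap a b x with x ≟ a
... | yes _ = b
... | no _ with x ≟ b
... | yes _ = a
... | no _ = x

IsABEdge : ∀ {n t} → Graph n → Coloring n t → Fin t → Fin t → Fin n × Fin n → Set
IsABEdge G f a b (u , v) = Edge G u v × (f u v ≡ a ⊎ f u v ≡ b)

ABStep : ∀ {n t} → Graph n → Coloring n t → Fin t → Fin t →
         Fin n × Fin n → Fin n × Fin n → Set
ABStep G f a b (u , v) (x , y) =
  IsABEdge G f a b (u , v) × IsABEdge G f a b (x , y) ×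
  (u ≡ x ⊎ u ≡ y ⊎ v ≡ x ⊎ v ≡ y)

-- g is obtained from f by switching colors a and b on the connected
-- component of G_f(a,b) containing the edge e₀ (an edge of G_f(a,b)).
-- The edge set of that component is the set of edges reachable from e₀
-- through ABStep.
Interchange : ∀ {n t} → Graph n → Coloring n t → Coloring n t → Set
Interchange {n} {t} G f g =
  Σ (Fin t) λ a → Σ (Fin t) λ b → Σ (Fin n × Fin n) λ e₀ →
    IsABEdge G f a b e₀ ×
    (∀ u v → Edge G u v →
       (Star (ABStep G f a b) e₀ (u , v) → g u v ≡ swap a b (f u v)) ×
       (¬ Star (ABStep G f a b) e₀ (u , v) → g u v ≡ f u v))

KempeEquivalent : ∀ {n t} → Graph n → Coloring n t → Coloring n t → Set
KempeEquivalent G = Star (Interchange G)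

AllKempeEquivalent : ∀ {n} → Graph n → ℕ → Set
AllKempeEquivalent {n} G t =
  (f g : Coloring n t) → IsProperColoring G f → IsProperColoring G g →
  KempeEquivalent G f g

{-# OPTIONS --safe #-}

-- If every degree is at most t and the vertices of degree t are independent, then a colour can
-- be eliminated from any (t+1)-edge-colouring by Kempe changes: this is Vizing's fan argument,
-- a fan that gets stuck at a vertex of degree t being restarted from there. So one may free a
-- colour and then paint any prescribed matching M with it; hence, if all t-colourings of G − M
-- are Kempe equivalent, so are all (t+1)-colourings of G.
--
-- Let M be a maximal matching of G and H = G − M; the vertices of degree k in H are independent.
-- It remains to treat the (k+1)-colourings of H. Since G is not k-colourable, H is not
-- (k−1)-colourable, and it is k-colourable by the elimination above. If Δ(H) = k − 1, the
-- assumption applies to H. If Δ(H) = k, a class M′ of a k-colouring of H covers the vertices of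
-- degree k, and the assumption applies to H − M′, whose chromatic index is k − 1.
module Submission where

open import Defs
open import Data.Nat using (ℕ; _≤_; _+_; _∸_)
open import Relation.Binary.PropositionalEquality using (_≡_)

open import Data.Bool using (Bool; true; false; not; _∧_)
open import Data.Bool.Properties using (not-involutive)
  renaming (_≟_ to _≟ᵇ_)
open import Data.Empty using (⊥)
open import Data.Fin using (Fin; zero; suc; _≟_)
open import Data.Fin.Properties using (any?; suc-injective)
open import Data.List using (List; []; _∷_; _++_; [_]; map; length; filter; foldr; allFin)
open import Data.List.Properties using (length-++; length-map; length-tabulate)
open import Data.List.Membership.Propositional using (_∈_; _∉_)
open import Data.List.Membership.DecPropositional using (_∈?_)
open import Data.List.Membership.Propositional.Properties
  using (∈-∃++; ∈-++⁺ˡ; ∈-++⁺ʳ; ∈-++⁻; ∈-filter⁺; ∈-filter⁻; ∈-allFin; ∈-map⁺)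
open import Data.List.Relation.Unary.All using ([]; _∷_)
  renaming (lookup to All-lookup; tabulate to All-tabulate)
open import Data.List.Relation.Unary.AllPairs using ([]; _∷_)
open import Data.List.Relation.Unary.Any using (here; there)
open import Data.List.Relation.Unary.Unique.Propositional using (Unique)
open import Data.List.Relation.Unary.Unique.Propositional.Properties using (allFin⁺; filter⁺)
open import Data.Nat using (zero; suc; _<_; z≤n; s≤s; _⊔_; s≤s⁻¹)
open import Data.Nat.Properties
  using (+-suc; +-comm; ≤-trans; ≤-refl; ≤-reflexive; ≤-antisym; <⇒≱; <-≤-trans; n≤1+n;
         m≤m⊔n; m≤n⊔m; ⊔-lub; ⊔-sel; <-cmp; m≤n⇒m<n∨m≡n; _≤?_; ≰⇒>; m≤m+n)
open import Data.Product using (Σ; ∃; ∃₂; _×_; _,_; proj₁; proj₂)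
open import Data.Sum using (_⊎_; inj₁; inj₂; [_,_]′)
  renaming (map to map-⊎)
open import Function using (id; _∘_)
open import Relation.Binary using (tri<; tri≈; tri>)
open import Relation.Binary.Construct.Closure.ReflexiveTransitive
  using (Star; ε; _◅_; _◅◅_; gmap; reverse)
open import Relation.Binary.PropositionalEquality
  using (_≢_; refl; trans; cong; cong₂; subst)
  renaming (sym to ≡-sym)
open import Relation.Nullary
  using (¬_; Dec; yes; no; does; contradiction; ¬?; _×-dec_; _⊎-dec_; decidable-stable)
open import Relation.Nullary.Decidable using (map′; toSum; dec-true; dec-false)
open import Relation.Unary using (Decidable)

-- Counting

-- Each step deletes the image of the head from `ys`; injectivity on `xs` keeps the images of the
-- tail within what is left.
image-length-≤ : ∀ {A B : Set} (φ : A → B) {xs ys} → Unique xs →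
  (∀ {x} → x ∈ xs → φ x ∈ ys) →
  (∀ {x x′} → x ∈ xs → x′ ∈ xs → φ x ≡ φ x′ → x ≡ x′) →
  length xs ≤ length ys
image-length-≤ φ [] into inj = z≤n
image-length-≤ {B = B} φ {x ∷ xs} (x∉xs ∷ xs!) into inj with ∈-∃++ (into (here refl))
... | as , bs , refl =
  ≤-trans (s≤s (image-length-≤ φ xs! avoid (λ p q → inj (there p) (there q))))
          (≤-reflexive (≡-sym suc-length))
  where
  suc-length : length (as ++ [ φ x ] ++ bs) ≡ suc (length (as ++ bs))
  suc-length rewrite length-++ as {[ φ x ] ++ bs} | length-++ as {bs} = +-suc (length as) (length bs)

  avoid : ∀ {x′} → x′ ∈ xs → φ x′ ∈ as ++ bs
  avoid x′∈ with ∈-++⁻ as (into (there x′∈))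
  ... | inj₁ i = ∈-++⁺ˡ i
  ... | inj₂ (there i) = ∈-++⁺ʳ as i
  ... | inj₂ (here eq) =
    contradiction (≡-sym (inj (there x′∈) (here refl) eq)) (All-lookup x∉xs x′∈)

⊆-length-≤ : ∀ {A : Set} {xs ys : List A} → Unique xs →
  (∀ {x} → x ∈ xs → x ∈ ys) → length xs ≤ length ys
⊆-length-≤ xs! sub = image-length-≤ id xs! sub (λ _ _ eq → eq)

length-allFin : ∀ n → length (allFin n) ≡ n
length-allFin n = length-tabulate {n = n} id

module _ {n} {P : Fin n → Set} (P? : Decidable P) where

  counted : List (Fin n)
  counted = filter P? (allFin n)

  count : ℕ
  count = length counted

  counted⁺ : ∀ {x} → P x → x ∈ counted
  counted⁺ {x} = ∈-filter⁺ P? (∈-allFin x)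

  counted⁻ : ∀ {x} → x ∈ counted → P x
  counted⁻ x∈ = proj₂ (∈-filter⁻ P? {xs = allFin n} x∈)

  counted-unique : Unique counted
  counted-unique = filter⁺ P? (allFin⁺ n)

module _ {n} {P Q : Fin n → Set} (P? : Decidable P) (Q? : Decidable Q) where

  count-image-≤ : (φ : Fin n → Fin n) → (∀ {x} → P x → Q (φ x)) →
    (∀ {x y} → P x → P y → φ x ≡ φ y → x ≡ y) → count P? ≤ count Q?
  count-image-≤ φ into inj = image-length-≤ φ (counted-unique P?)
    (λ x∈ → counted⁺ Q? (into (counted⁻ P? x∈)))
    (λ x∈ y∈ → inj (counted⁻ P? x∈) (counted⁻ P? y∈))

  count-≤ : (∀ {x} → P x → Q x) → count P? ≤ count Q?
  count-≤ sub = count-image-≤ id sub (λ _ _ eq → eq)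

  count-< : ∀ {w} → (∀ {x} → P x → Q x) → Q w → ¬ P w → count P? < count Q?
  count-< {w} sub qw ¬pw = ⊆-length-≤ {xs = w ∷ counted P?}
    (All-tabulate (λ x∈ → λ { refl → ¬pw (counted⁻ P? x∈) }) ∷ counted-unique P?)
    λ { (here refl) → counted⁺ Q? qw
      ; (there x∈) → counted⁺ Q? (sub (counted⁻ P? x∈)) }

  count-≤-suc : ∀ w → (∀ {x} → P x → x ≡ w ⊎ Q x) → count P? ≤ suc (count Q?)
  count-≤-suc w sub = ⊆-length-≤ {ys = w ∷ counted Q?} (counted-unique P?) into
    where
    into : ∀ {x} → x ∈ counted P? → x ∈ w ∷ counted Q?
    into x∈ with sub (counted⁻ P? x∈)
    ... | inj₁ refl = here refl
    ... | inj₂ q = there (counted⁺ Q? q)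

  -- P loses w and gains at most one new element, so an injection sends the new one to w.
  count-exchange-≤ : ∀ w → Q w → ¬ P w →
    (∀ {x y} → P x → ¬ Q x → P y → ¬ Q y → x ≡ y) → count P? ≤ count Q?
  count-exchange-≤ w qw ¬pw new = count-image-≤ φ into inj
    where
    φ : Fin n → Fin n
    φ x with Q? x
    ... | yes _ = x
    ... | no _ = w

    into : ∀ {x} → P x → Q (φ x)
    into {x} p with Q? x
    ... | yes q = q
    ... | no _ = qw

    inj : ∀ {x y} → P x → P y → φ x ≡ φ y → x ≡ y
    inj {x} {y} px py eq with Q? x | Q? y
    ... | yes _ | yes _ = eq
    ... | no ¬q | no ¬q′ = new px ¬q py ¬q′
    ... | yes _ | no _ = contradiction (subst P eq px) ¬pw
    ... | no _ | yes _ = contradiction (subst P (≡-sym eq) py) ¬pw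

-- Decidable reachability

-- Warshall's algorithm: paths whose inner vertices lie in a given list.
module _ {n} {R : Fin n → Fin n → Set} (R? : ∀ x y → Dec (R x y)) where

  Via : List (Fin n) → Fin n → Fin n → Set
  Via [] x y = x ≡ y ⊎ R x y
  Via (z ∷ zs) x y = Via zs x y ⊎ Via zs x z × Via zs z y

  via? : ∀ zs x y → Dec (Via zs x y)
  via? [] x y = x ≟ y ⊎-dec R? x y
  via? (z ∷ zs) x y = via? zs x y ⊎-dec (via? zs x z ×-dec via? zs z y)

  via⇒star : ∀ zs {x y} → Via zs x y → Star R x y
  via⇒star [] (inj₁ refl) = ε
  via⇒star [] (inj₂ r) = r ◅ ε
  via⇒star (z ∷ zs) (inj₁ p) = via⇒star zs p
  via⇒star (z ∷ zs) (inj₂ (p , q)) = via⇒star zs p ◅◅ via⇒star zs q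

  via-base : ∀ zs {x y} → Via [] x y → Via zs x y
  via-base [] p = p
  via-base (z ∷ zs) p = inj₁ (via-base zs p)

  via-to : ∀ {z zs x} → Via (z ∷ zs) x z → Via zs x z
  via-to (inj₁ p) = p
  via-to (inj₂ (p , _)) = p

  via-from : ∀ {z zs y} → Via (z ∷ zs) z y → Via zs z y
  via-from (inj₁ p) = p
  via-from (inj₂ (_ , q)) = q

  -- The joint `m` becomes an inner vertex, hence `m ∈ zs`. If both pieces pass through `z`, the
  -- closed part between the two visits is dropped.
  via-trans : ∀ {zs x m y} → m ∈ zs → Via zs x m → Via zs m y → Via zs x y
  via-trans {z ∷ zs} (here refl) p q = inj₂ (via-to p , via-from q)
  via-trans (there m∈) (inj₁ p) (inj₁ q) = inj₁ (via-trans m∈ p q)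
  via-trans (there m∈) (inj₁ p) (inj₂ (q , r)) = inj₂ (via-trans m∈ p q , r)
  via-trans (there m∈) (inj₂ (p , q)) (inj₁ r) = inj₂ (p , via-trans m∈ q r)
  via-trans (there m∈) (inj₂ (p , _)) (inj₂ (_ , r)) = inj₂ (p , r)

  star⇒via : ∀ {x y} → Star R x y → Via (allFin n) x y
  star⇒via ε = via-base (allFin n) (inj₁ refl)
  star⇒via (_◅_ {j = m} r rs) =
    via-trans (∈-allFin m) (via-base (allFin n) (inj₂ r)) (star⇒via rs)

  star? : ∀ x y → Dec (Star R x y)
  star? x y = map′ (via⇒star (allFin n)) star⇒via (via? (allFin n) x y)

-- Swapping two colours

swap-left : ∀ {t} (a b : Fin t) → swap a b a ≡ b
swap-left a b with a ≟ a
... | yes _ = refl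
... | no a≢a = contradiction refl a≢a

swap-right : ∀ {t} (a b : Fin t) → swap a b b ≡ a
swap-right a b with b ≟ a
... | yes b≡a = b≡a
... | no _ with b ≟ b
...   | yes _ = refl
...   | no b≢b = contradiction refl b≢b

swap-other : ∀ {t} {a b x : Fin t} → x ≢ a → x ≢ b → swap a b x ≡ x
swap-other {a = a} {b} {x} x≢a x≢b with x ≟ a
... | yes x≡a = contradiction x≡a x≢a
... | no _ with x ≟ b
...   | yes x≡b = contradiction x≡b x≢b
...   | no _ = refl

swap-involutive : ∀ {t} (a b x : Fin t) → swap a b (swap a b x) ≡ x
swap-involutive a b x with x ≟ a
... | yes refl = swap-right x b
... | no x≢a with x ≟ b
...   | yes refl = swap-left a x
...   | no x≢b = swap-other x≢a x≢b

swap-same : ∀ {t} (a x : Fin t) → swap a a x ≡ x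
swap-same a x with x ≟ a
... | yes x≡a = ≡-sym x≡a
... | no x≢a with x ≟ a
...   | yes x≡a = contradiction x≡a x≢a
...   | no _ = refl

swap-suc : ∀ {t} (a b x : Fin t) → swap (suc a) (suc b) (suc x) ≡ suc (swap a b x)
swap-suc a b x with x ≟ a
... | yes _ = refl
... | no _ with x ≟ b
...   | yes _ = refl
...   | no _ = refl

-- Kempe changes

module _ {n} (G : Graph n) where

  edge? : ∀ u v → Dec (Edge G u v)
  edge? u v = adj G u v ≟ᵇ true

  edge-sym : ∀ {u v} → Edge G u v → Edge G v u
  edge-sym {u} {v} e = trans (sym G v u) e

  edge-≢ : ∀ {u v} → Edge G u v → u ≢ v
  edge-≢ {u} e refl with trans (≡-sym e) (irrefl G u)
  ... | ()

module Kempe {n} (G : Graph n) (t : ℕ) where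

  Proper : Coloring n t → Set
  Proper = IsProperColoring G

  _≈_ : Coloring n t → Coloring n t → Set
  f ≈ g = ∀ u v → Edge G u v → f u v ≡ g u v

  Has : Coloring n t → Fin n → Fin t → Set
  Has f v c = ∃ λ w → Edge G v w × f v w ≡ c

  has? : ∀ f v c → Dec (Has f v c)
  has? f v c = any? (λ w → edge? G v w ×-dec (f v w ≟ c))

  has-end : ∀ {f} → Proper f → ∀ {u v c} → Edge G u v → f u v ≡ c → Has f v c
  has-end (f-sym , _) {u} {v} e eq = u , edge-sym G e , trans (≡-sym (f-sym u v e)) eq

  same-end : ∀ {f} → Proper f → ∀ {v w w′} → Edge G v w → Edge G v w′ →
    f v w ≡ f v w′ → w ≡ w′
  same-end (_ , f-dist) {v} {w} {w′} e e′ eq =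
    decidable-stable (w ≟ w′) (λ w≢w′ → f-dist v w w′ e e′ w≢w′ eq)

  ab? : ∀ (f : Coloring n t) a b e → Dec (IsABEdge G f a b e)
  ab? f a b (u , v) = edge? G u v ×-dec ((f u v ≟ a) ⊎-dec (f u v ≟ b))

  -- Colourings also take values off the edges, so agreement on edges is not equality. Exchanging a
  -- colour with itself bridges the gap; the edge `uv` serves as the starting edge that an
  -- interchange must name.
  ≈⇒interchange : ∀ {u v} → Edge G u v → ∀ {f g} → f ≈ g → Interchange G f g
  ≈⇒interchange {u} {v} e {f} f≈g = f u v , f u v , (u , v) , (e , inj₁ refl) ,
    λ u′ v′ e′ → (λ _ → trans (≡-sym (f≈g u′ v′ e′)) (≡-sym (swap-same (f u v) (f u′ v′)))) ,
                 (λ _ → ≡-sym (f≈g u′ v′ e′))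

  -- The edges coloured `a` or `b` are the same under `f` and `g`, hence so is the component, and a
  -- second swap on it undoes the first.
  interchange-sym : ∀ {f g} → Interchange G f g → Interchange G g f
  interchange-sym {f} {g} (a , b , (u₀ , v₀) , (e₀ , ab₀) , h) =
    a , b , (u₀ , v₀) , swapped (e₀ , ab₀) ,
    λ u v e → (λ s → unswap (proj₁ (h u v e) (back s))) ,
              (λ ¬s → ≡-sym (proj₂ (h u v e) (¬s ∘ forth)))
    where
    unswap : ∀ {x y} → y ≡ swap a b x → x ≡ swap a b y
    unswap {x} refl = ≡-sym (swap-involutive a b x)

    swap-ab : ∀ {x y} → y ≡ swap a b x → x ≡ a ⊎ x ≡ b → y ≡ a ⊎ y ≡ b
    swap-ab refl (inj₁ refl) = inj₂ (swap-left a b)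
    swap-ab refl (inj₂ refl) = inj₁ (swap-right a b)

    -- Membership in the component is not decided here, so the two cases are available only under a
    -- double negation; being an `a`/`b`-edge is decidable, which removes it.
    value : ∀ {u v} → Edge G u v → ¬ ¬ (g u v ≡ swap a b (f u v) ⊎ g u v ≡ f u v)
    value {u} {v} e no-value = no-value
      (inj₂ (proj₂ (h u v e) (λ s → no-value (inj₁ (proj₁ (h u v e) s)))))

    swapped : ∀ {e} → IsABEdge G f a b e → IsABEdge G g a b e
    swapped {u , v} (e , ab) = decidable-stable (ab? g a b (u , v)) λ ¬ab →
      value e λ { (inj₁ eq) → ¬ab (e , swap-ab eq ab)
                ; (inj₂ eq) → ¬ab (e , subst (λ c → c ≡ a ⊎ c ≡ b) (≡-sym eq) ab) }

    unswapped : ∀ {e} → IsABEdge G g a b e → IsABEdge G f a b e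
    unswapped {u , v} (e , ab) = decidable-stable (ab? f a b (u , v)) λ ¬ab →
      value e λ { (inj₁ eq) → ¬ab (e , swap-ab (unswap eq) ab)
                ; (inj₂ eq) → ¬ab (e , subst (λ c → c ≡ a ⊎ c ≡ b) eq ab) }

    forth : ∀ {e e′} → Star (ABStep G f a b) e e′ → Star (ABStep G g a b) e e′
    forth = gmap id (λ { (x , y , z) → swapped x , swapped y , z })

    back : ∀ {e e′} → Star (ABStep G g a b) e e′ → Star (ABStep G f a b) e e′
    back = gmap id (λ { (x , y , z) → unswapped x , unswapped y , z })

  kempe-sym : ∀ {f g} → KempeEquivalent G f g → KempeEquivalent G g f
  kempe-sym = reverse interchange-sym

  -- Switching two colours on the component of a vertex

  module Switch {f : Coloring n t} (f-proper : Proper f) (p q : Fin t) where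

    PQ : Fin n → Fin n → Set
    PQ u v = IsABEdge G f p q (u , v)

    pq-sym : ∀ {u v} → PQ u v → PQ v u
    pq-sym {u} {v} (e , c) =
      edge-sym G e , subst (λ x → x ≡ p ⊎ x ≡ q) (proj₁ f-proper u v e) c

    Conn : Fin n → Fin n → Set
    Conn = Star PQ

    conn? : ∀ u v → Dec (Conn u v)
    conn? = star? (λ u v → ab? f p q (u , v))

    conn-sym : ∀ {u v} → Conn u v → Conn v u
    conn-sym = reverse pq-sym

    -- Testing only the first end is consistent: the ends of an edge coloured `p` or `q` lie in one
    -- component, and the swap fixes all other colours.
    switch : Fin n → Coloring n t
    switch v u w with conn? v u
    ... | yes _ = swap p q (f u w)
    ... | no _ = f u w

    switch-in : ∀ {v u} → Conn v u → ∀ w → switch v u w ≡ swap p q (f u w)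
    switch-in {v} {u} s w with conn? v u
    ... | yes _ = refl
    ... | no ¬s = contradiction s ¬s

    switch-out : ∀ {v u} → ¬ Conn v u → ∀ w → switch v u w ≡ f u w
    switch-out {v} {u} ¬s w with conn? v u
    ... | yes s = contradiction s ¬s
    ... | no _ = refl

    switch-fixes : ∀ v {u w} → f u w ≢ p → f u w ≢ q → switch v u w ≡ f u w
    switch-fixes v {u} {w} ≢p ≢q with conn? v u
    ... | yes _ = swap-other ≢p ≢q
    ... | no _ = refl

    swap-injective : ∀ {x y} → swap p q x ≡ swap p q y → x ≡ y
    swap-injective {x} {y} eq =
      trans (≡-sym (swap-involutive p q x)) (trans (cong (swap p q) eq) (swap-involutive p q y))

    switch-proper : ∀ v → Proper (switch v)
    switch-proper v = symmetric , distinct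
      where
      symmetric : ∀ u w → Edge G u w → switch v u w ≡ switch v w u
      symmetric u w e with ab? f p q (u , w)
      ... | no ¬pq = trans (switch-fixes v (¬pq ∘ (e ,_) ∘ inj₁) (¬pq ∘ (e ,_) ∘ inj₂))
          (trans eq (≡-sym (switch-fixes v (λ x → ¬pq (e , inj₁ (trans eq x)))
                                           (λ x → ¬pq (e , inj₂ (trans eq x))))))
        where
        eq = proj₁ f-proper u w e
      ... | yes pq = along pq
        where
        along : PQ u w → switch v u w ≡ switch v w u
        along pq with conn? v u | conn? v w
        ... | yes _ | yes _ = cong (swap p q) (proj₁ f-proper u w e)
        ... | no _ | no _ = proj₁ f-proper u w e
        ... | yes s | no ¬s = contradiction (s ◅◅ pq ◅ ε) ¬s
        ... | no ¬s | yes s = contradiction (s ◅◅ pq-sym pq ◅ ε) ¬s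

      distinct : ∀ u w w′ → Edge G u w → Edge G u w′ → w ≢ w′ → switch v u w ≢ switch v u w′
      distinct u w w′ e e′ w≢w′ eq with conn? v u
      ... | yes _ = proj₂ f-proper u w w′ e e′ w≢w′ (swap-injective eq)
      ... | no _ = proj₂ f-proper u w w′ e e′ w≢w′ eq

    -- Interchanges are defined by walks from edge to edge, `Conn` by walks from vertex to vertex;
    -- this and `star⇒conn` translate between the two.
    conn⇒star : ∀ {v u w₀ w} → Conn v u → PQ v w₀ → PQ u w →
      Star (ABStep G f p q) (v , w₀) (u , w)
    conn⇒star ε x y = (x , y , inj₁ refl) ◅ ε
    conn⇒star (z ◅ s) x y = (x , pq-sym z , inj₂ (inj₁ refl)) ◅ conn⇒star s (pq-sym z) y

    star⇒conn : ∀ {v a b c d} → Star (ABStep G f p q) (a , b) (c , d) →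
      Conn v a × Conn v b → Conn v c
    star⇒conn ε (s , _) = s
    star⇒conn {v} {a} {b} (_◅_ {j = x , y} (_ , xy , meet) rest) (sa , sb) =
      star⇒conn rest (both meet)
      where
      from-x : Conn v x → Conn v x × Conn v y
      from-x s = s , s ◅◅ xy ◅ ε
      from-y : Conn v y → Conn v x × Conn v y
      from-y s = s ◅◅ pq-sym xy ◅ ε , s
      both : a ≡ x ⊎ a ≡ y ⊎ b ≡ x ⊎ b ≡ y → Conn v x × Conn v y
      both (inj₁ refl) = from-x sa
      both (inj₂ (inj₁ refl)) = from-y sa
      both (inj₂ (inj₂ (inj₁ refl))) = from-x sb
      both (inj₂ (inj₂ (inj₂ refl))) = from-y sb

    switch-interchange : ∀ {x y} → Edge G x y → ∀ v → Interchange G f (switch v)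
    switch-interchange xy v with any? (λ w → ab? f p q (v , w))
    ... | yes (w₀ , pq₀) = p , q , (v , w₀) , pq₀ , λ u w e →
            (λ s → switch-in (star⇒conn s (ε , pq₀ ◅ ε)) w) , outside u w e
      where
      outside : ∀ u w → Edge G u w → ¬ Star (ABStep G f p q) (v , w₀) (u , w) →
        switch v u w ≡ f u w
      outside u w e ¬s with ab? f p q (u , w)
      ... | no ¬pq = switch-fixes v (¬pq ∘ (e ,_) ∘ inj₁) (¬pq ∘ (e ,_) ∘ inj₂)
      ... | yes pq = switch-out (λ s → ¬s (conn⇒star s pq₀ pq)) w
    -- Here `v` is isolated in the two-coloured subgraph, so no edge changes colour and the trivial
    -- interchange at `xy` does.
    ... | no ¬pq = ≈⇒interchange xy unchanged
      where
      unchanged : f ≈ switch v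
      unchanged u w e with ab? f p q (u , w)
      ... | no ¬pq′ = ≡-sym (switch-fixes v (¬pq′ ∘ (e ,_) ∘ inj₁) (¬pq′ ∘ (e ,_) ∘ inj₂))
      ... | yes pq = ≡-sym (switch-out apart w)
        where
        apart : ¬ Conn v u
        apart ε = ¬pq (w , pq)
        apart (pq′ ◅ _) = ¬pq (_ , pq′)

    has-switch-in : ∀ {v u c} → Conn v u → Has (switch v) u c → Has f u (swap p q c)
    has-switch-in {v} {u} s (w , e , eq) = w , e ,
      trans (≡-sym (swap-involutive p q (f u w)))
            (cong (swap p q) (trans (≡-sym (switch-in s w)) eq))

    has-switch-out : ∀ {v u c} → ¬ Conn v u → Has (switch v) u c → Has f u c
    has-switch-out ¬s (w , e , eq) = w , e , trans (≡-sym (switch-out ¬s w)) eq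

    switch-other⁺ : ∀ v {c u w} → c ≢ p → c ≢ q → f u w ≡ c → switch v u w ≡ c
    switch-other⁺ v c≢p c≢q refl = switch-fixes v c≢p c≢q

    switch-other⁻ : ∀ v {c u w} → c ≢ p → c ≢ q → switch v u w ≡ c → f u w ≡ c
    switch-other⁻ v {c} {u} {w} c≢p c≢q eq with conn? v u
    ... | yes _ = swap-injective (trans eq (≡-sym (swap-other c≢p c≢q)))
    ... | no _ = eq

    has-switch-other : ∀ v {c u} → c ≢ p → c ≢ q → Has (switch v) u c → Has f u c
    has-switch-other v c≢p c≢q (w , e , eq) = w , e , switch-other⁻ v c≢p c≢q eq

    -- A component containing a vertex v that misses q is a path starting at v, hence has at
    -- most one further end: walks from v alternate p, q and are determined by their length.
    module _ {v : Fin n} (¬vq : ¬ Has f v q) where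

      colour : Bool → Fin t
      colour true = p
      colour false = q

      data Walk : ℕ → Bool → Fin n → Set where
        start : Walk 0 true v
        step : ∀ {l b u w} → Walk l b u → Edge G u w → f u w ≡ colour b → Walk (suc l) (not b) w

      extend : ∀ {l b u w} → Walk l b u → PQ u w → ∃₂ λ l′ b′ → Walk l′ b′ w
      extend {l} {b} {u} {w} walk (e , c) with side b c
        where
        side : ∀ b → f u w ≡ p ⊎ f u w ≡ q → f u w ≡ colour b ⊎ f u w ≡ colour (not b)
        side true c = c
        side false (inj₁ x) = inj₂ x
        side false (inj₂ x) = inj₁ x
      ... | inj₁ eq = _ , _ , step walk e eq
      -- The edge has the colour just used, so it is the last edge traversed backwards and the walk
      -- gets shorter. At the start this colour would be `q`, which `v` misses.
      ... | inj₂ eq with walk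
      ...   | start = contradiction (w , e , eq) ¬vq
      ...   | step {l} {b} {u′} prev e′ eq′ = l , b , subst (Walk l b) u′≡w prev
        where
        u′≡w : u′ ≡ w
        u′≡w = same-end f-proper (edge-sym G e′) e
          (trans (≡-sym (proj₁ f-proper u′ u e′))
            (trans eq′ (trans (cong colour (≡-sym (not-involutive b))) (≡-sym eq))))

      walk-to : ∀ {l b u w} → Walk l b u → Conn u w → ∃₂ λ l′ b′ → Walk l′ b′ w
      walk-to walk ε = _ , _ , walk
      walk-to walk (pq ◅ s) = walk-to (proj₂ (proj₂ (extend walk pq))) s

      walk-unique : ∀ {l b b′ u u′} → Walk l b u → Walk l b′ u′ → b ≡ b′ × u ≡ u′
      walk-unique start start = refl , refl
      walk-unique (step x e eq) (step y e′ eq′) with walk-unique x y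
      ... | refl , refl = refl , same-end f-proper e e′ (trans eq (≡-sym eq′))

      -- By `walk-unique` the longer walk is at `u` after `l` steps, and it leaves `u` along the
      -- next colour.
      continues : ∀ {l l′ b b′ u u′} → Walk l b u → Walk l′ b′ u′ → l < l′ → Has f u (colour b)
      continues x (step y e eq) (s≤s l≤) with m≤n⇒m<n∨m≡n l≤
      ... | inj₁ l< = continues x y l<
      ... | inj₂ refl with walk-unique x y
      ...   | refl , refl = _ , e , eq

      End : Fin n → Set
      End u = ¬ Has f u p ⊎ ¬ Has f u q

      -- The walk arrives at `u` along one of the two colours, so the colour missing there is the
      -- other one, which the next step would need.
      end-stops : ∀ {l b u} → u ≢ v → End u → Walk l b u → ¬ Has f u (colour b)
      end-stops u≢v end start = contradiction refl u≢v
      end-stops {u = u} u≢v end (step {b = b} {u = u′} x e eq) = other b eq end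
        where
        other : ∀ b → f u′ u ≡ colour b → End u → ¬ Has f u (colour (not b))
        other true eq (inj₁ ¬p) = contradiction (has-end f-proper e eq) ¬p
        other true eq (inj₂ ¬q) = ¬q
        other false eq (inj₁ ¬p) = ¬p
        other false eq (inj₂ ¬q) = contradiction (has-end f-proper e eq) ¬q

      end-unique : ∀ {y z} → y ≢ v → z ≢ v → Conn v y → Conn v z → End y → End z → y ≡ z
      end-unique y≢v z≢v sy sz ey ez with walk-to start sy | walk-to start sz
      ... | l , _ , wy | l′ , _ , wz with <-cmp l l′
      ...   | tri< l<l′ _ _ = contradiction (continues wy wz l<l′) (end-stops y≢v ey wy)
      ...   | tri≈ _ refl _ = proj₂ (walk-unique wy wz)
      ...   | tri> _ _ l′<l = contradiction (continues wz wy l′<l) (end-stops z≢v ez wz)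

  -- An edge determines its colour, so the distinct colours `ψ i` are found on distinct edges at
  -- `v`.
  saturated : ∀ {f v s} (ψ : Fin s → Fin t) → (∀ {i j} → ψ i ≡ ψ j → i ≡ j) →
    (∀ i → Has f v (ψ i)) → s ≤ deg G v
  saturated {f} {v} {s} ψ ψ-inj has = subst (_≤ deg G v) (length-allFin s)
    (image-length-≤ (proj₁ ∘ has) (allFin⁺ s)
      (λ {i} _ → counted⁺ (edge? G v) (proj₁ (proj₂ (has i))))
      (λ {i} {j} _ _ eq → ψ-inj (trans (≡-sym (proj₂ (proj₂ (has i))))
                                  (trans (cong (f v) eq) (proj₂ (proj₂ (has j)))))))

-- Removing one colour by Kempe changes

-- Colour 0 plays the role of "uncoloured" in Vizing's fan argument. Shifting that colour
-- along a fan is done by (0, c)-switches, and progress is measured by the vertices it meets.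
module Reduction {n} (G : Graph n) (t : ℕ) {a b} (ab : Edge G a b)
  (deg≤t : ∀ v → deg G v ≤ t) where

  open Kempe G (suc t)

  zeros : Coloring n (suc t) → ℕ
  zeros f = count (λ v → has? f v zero)

  record Decrease (f : Coloring n (suc t)) : Set where
    constructor decrease
    field
      {result} : Coloring n (suc t)
      kempe : KempeEquivalent G f result
      proper : Proper result
      fewer : zeros result < zeros f

  decrease-via : ∀ {f f′} → KempeEquivalent G f f′ → zeros f′ ≤ zeros f → Decrease f′ → Decrease f
  decrease-via k le (decrease k′ pr lt) = decrease (k ◅◅ k′) pr (<-≤-trans lt le)

  module _ {f} (f-proper : Proper f) {c} (c≢0 : c ≢ zero) {v}
    (v-zero : Has f v zero) (v-misses : ¬ Has f v c) where

    open Switch f-proper zero c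

    private
      lost : ¬ Has (switch v) v zero
      lost h = v-misses (subst (Has f v) (swap-left zero c) (has-switch-in ε h))

      gained-conn : ∀ {u} → Has (switch v) u zero → ¬ Has f u zero → Conn v u
      gained-conn {u} h ¬h = decidable-stable (conn? v u) (λ ¬s → ¬h (has-switch-out ¬s h))

      ≢v : ∀ {u} → ¬ Has f u zero → u ≢ v
      ≢v ¬h refl = ¬h v-zero

    -- The component is a path starting at `v`: colour 0 disappears at `v` and can newly appear only
    -- at the other end.
    switch-zeros-≤ : zeros (switch v) ≤ zeros f
    switch-zeros-≤ = count-exchange-≤ (λ u → has? (switch v) u zero) (λ u → has? f u zero)
      v v-zero lost
      (λ hx ¬hx hy ¬hy → end-unique v-misses (≢v ¬hx) (≢v ¬hy)
        (gained-conn hx ¬hx) (gained-conn hy ¬hy) (inj₁ ¬hx) (inj₁ ¬hy))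

    -- The other end of the path is now `x`, which meets 0 already, so nothing makes up for the loss
    -- at `v`.
    switch-zeros-< : ∀ {x} → x ≢ v → Conn v x → Has f x zero → ¬ Has f x c →
      zeros (switch v) < zeros f
    switch-zeros-< {x} x≢v s x-zero x-misses =
      count-< (λ u → has? (switch v) u zero) (λ u → has? f u zero) kept v-zero lost
      where
      kept : ∀ {u} → Has (switch v) u zero → Has f u zero
      kept {u} h = decidable-stable (has? f u zero) λ ¬h →
        ¬h (subst (λ w → Has f w zero)
          (end-unique v-misses x≢v (≢v ¬h) s (gained-conn h ¬h) (inj₂ x-misses) (inj₁ ¬h))
          x-zero)

  -- Vizing fans and their shifts

  module Fans {x y₀} (e₀ : Edge G x y₀) where

    -- A Vizing fan centred at `x`: the last index is its final vertex, the list holds the earlier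
    -- ones, latest first.
    data Fan (f : Coloring n (suc t)) : List (Fin n) → Fin n → Set where
      base : Fan f [] y₀
      grow : ∀ {ys y z} → Fan f ys y → Edge G x z → ¬ Has f y (f x z) → z ∉ y ∷ ys →
        Fan f (y ∷ ys) z

    fan-edge : ∀ {f ys y w} → Fan f ys y → w ∈ y ∷ ys → Edge G x w
    fan-edge base (here refl) = e₀
    fan-edge (grow fan e _ _) (here refl) = e
    fan-edge (grow fan e _ _) (there w∈) = fan-edge fan w∈

    fan-base : ∀ {f ys y} → Fan f ys y → y₀ ∈ y ∷ ys
    fan-base base = here refl
    fan-base (grow fan _ _ _) = there (fan-base fan)

    fan-unique : ∀ {f ys y} → Fan f ys y → Unique (y ∷ ys)
    fan-unique base = [] ∷ []
    fan-unique (grow fan _ _ z∉) = All-tabulate (λ w∈ → λ { refl → z∉ w∈ }) ∷ fan-unique fan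

    fresh-colour : ∀ {f} → Proper f → ∀ {ys y z w} → Fan f ys y → Edge G x z →
      z ∉ y ∷ ys → w ∈ y ∷ ys → f x w ≢ f x z
    fresh-colour f-proper fan e z∉ w∈ eq =
      z∉ (subst (_∈ _) (same-end f-proper (fan-edge fan w∈) e eq) w∈)

    -- Colour classes that do not occur on the spokes stay the same: `keep⁺` lets the next spoke's
    -- colour be read off, and `keep⁻` preserves missing colours.
    record Shifted (f : Coloring n (suc t)) (ys : List (Fin n)) (y : Fin n) : Set where
      field
        result : Coloring n (suc t)
        kempe : KempeEquivalent G f result
        proper : Proper result
        zeros-≤ : zeros result ≤ zeros f
        zero-at : result x y ≡ zero
        keep⁺ : ∀ {c} → c ≢ zero → (∀ {w} → w ∈ y ∷ ys → f x w ≢ c) →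
          ∀ {u v} → f u v ≡ c → result u v ≡ c
        keep⁻ : ∀ {c} → c ≢ zero → (∀ {w} → w ∈ y ∷ ys → f x w ≢ c) →
          ∀ {u v} → result u v ≡ c → f u v ≡ c

      misses : ∀ {c v} → c ≢ zero → (∀ {w} → w ∈ y ∷ ys → f x w ≢ c) →
        ¬ Has f v c → ¬ Has result v c
      misses c≢0 c∉ ¬h (w , e , eq) = ¬h (w , e , keep⁻ c≢0 c∉ eq)

    -- Once `xy` has colour 0, the (0, c)-path from `y`, which misses `c`, begins with `yx` and
    -- `xz`, so switching it gives `xz` colour 0. The rest of the path changes too, but only in the
    -- colours 0 and `c`.
    shift : ∀ {f} → Proper f → f x y₀ ≡ zero → ∀ {ys y} → Fan f ys y → Shifted f ys y
    shift {f} f-proper eq₀ base = record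
      { result = f ; kempe = ε ; proper = f-proper ; zeros-≤ = ≤-refl ; zero-at = eq₀
      ; keep⁺ = λ _ _ eq → eq ; keep⁻ = λ _ _ eq → eq }
    shift {f} f-proper eq₀ (grow {ys} {y} {z} fan e ¬h z∉) = record
      { result = switch y
      ; kempe = kempe ◅◅ switch-interchange ab y ◅ ε
      ; proper = switch-proper y
      ; zeros-≤ = ≤-trans (switch-zeros-≤ proper c≢0 y-zero y-misses) zeros-≤
      ; zero-at = trans (switch-in y∼x z) (trans (cong (swap zero c) (keep⁺ c≢0 c∉ refl))
                                                 (swap-right zero c))
      ; keep⁺ = λ d≢0 d∉ eq → switch-other⁺ y d≢0 (d∉ (here refl) ∘ ≡-sym)
                                (keep⁺ d≢0 (d∉ ∘ there) eq)
      ; keep⁻ = λ d≢0 d∉ eq → keep⁻ d≢0 (d∉ ∘ there)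
                                (switch-other⁻ y d≢0 (d∉ (here refl) ∘ ≡-sym) eq)
      }
      where
      open Shifted (shift f-proper eq₀ fan)
      c = f x z

      c∉ : ∀ {w} → w ∈ y ∷ ys → f x w ≢ c
      c∉ = fresh-colour f-proper fan e z∉

      c≢0 : c ≢ zero
      c≢0 eq = c∉ (fan-base fan) (trans eq₀ (≡-sym eq))

      y-edge : Edge G x y
      y-edge = fan-edge fan (here refl)

      y-zero : Has result y zero
      y-zero = has-end proper y-edge zero-at

      y-misses : ¬ Has result y c
      y-misses = misses c≢0 c∉ ¬h

      open Switch proper zero c

      y∼x : Conn y x
      y∼x = pq-sym (y-edge , inj₁ zero-at) ◅ ε

    -- After the shift `xy` has colour 0 and both its ends miss `c`, so it is a (0, c)-component by
    -- itself; switching it takes 0 away from both ends.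
    finish : ∀ {f} → Proper f → f x y₀ ≡ zero → ∀ {ys y c} → Fan f ys y →
      c ≢ zero → ¬ Has f x c → ¬ Has f y c → Decrease f
    finish {f} f-proper eq₀ {ys} {y} {c} fan c≢0 x-misses y-misses =
      decrease-via kempe zeros-≤ (decrease (switch-interchange ab y ◅ ε) (switch-proper y)
        (switch-zeros-< proper c≢0 (has-end proper y-edge zero-at) (misses c≢0 c∉ y-misses)
          (edge-≢ G y-edge) (pq-sym (y-edge , inj₁ zero-at) ◅ ε)
          (y , y-edge , zero-at) (misses c≢0 c∉ x-misses)))
      where
      open Shifted (shift f-proper eq₀ fan)
      open Switch proper zero c

      c∉ : ∀ {w} → w ∈ y ∷ ys → f x w ≢ c
      c∉ w∈ eq = x-misses (_ , fan-edge fan w∈ , eq)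

      y-edge : Edge G x y
      y-edge = fan-edge fan (here refl)

    module _ {f} (f-proper : Proper f) (eq₀ : f x y₀ ≡ zero) where

      -- What lets a fan survive a recolouring: spoke colours that were missing stay missing. The
      -- colour of `xz` is exempt because `close-cycle` switches it.
      Carries : Coloring n (suc t) → Fin n → Set
      Carries f′ z = ∀ {u w} → Edge G x w → f x w ≢ f x z → Has f′ u (f x w) → Has f u (f x w)

      transfer : ∀ {f′ ys y z} → Edge G x z → Fan f ys y → z ∉ y ∷ ys →
        (∀ w → f′ x w ≡ f x w) → Carries f′ z → Fan f′ ys y
      transfer e base z∉ same carries = base
      transfer {f′} e (grow {y = y} fan e′ ¬h z′∉) z∉ same carries =
        grow (transfer e fan (z∉ ∘ there) same carries) e′
          (λ h → ¬h (carries e′ (λ eq → z∉ (here (same-end f-proper e e′ (≡-sym eq))))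
                       (subst (Has f′ y) (same _) h)))
          z′∉

      -- The fan is cut before z, at the vertex whose missing colour is that of xz.
      record Split (ys : List (Fin n)) (y z : Fin n) : Set where
        field
          {front} : List (Fin n)
          cut : Fin n
          prefix : Fan f front cut
          fresh : z ∉ cut ∷ front
          cut∈ : cut ∈ ys
          cut-misses : ¬ Has f cut (f x z)
          rebuild : ∀ {f′} → (∀ w → f′ x w ≡ f x w) → ¬ Has f′ cut (f x z) →
            Carries f′ z → Fan f′ ys y

      split : ∀ {ys y z} → Edge G x z → f x z ≢ zero → Fan f ys y → z ∈ y ∷ ys → Split ys y z
      split e ≢0 base (here refl) = contradiction eq₀ ≢0
      split e ≢0 (grow {y = y} fan e′ ¬h z∉) (here refl) = record
        { cut = y ; prefix = fan ; fresh = z∉ ; cut∈ = here refl ; cut-misses = ¬h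
        ; rebuild = λ {f′} same miss carries →
            grow (transfer e fan z∉ same carries) e (miss ∘ subst (Has f′ y) (same _)) z∉ }
      split e ≢0 (grow {y = y} fan e′ ¬h z′∉) (there z∈) = record
        { cut = cut ; prefix = prefix ; fresh = fresh ; cut∈ = there cut∈
        ; cut-misses = cut-misses
        ; rebuild = λ {f′} same miss carries → grow (rebuild same miss carries) e′
            (λ h → ¬h (carries e′
              (λ eq → z′∉ (subst (_∈ _) (same-end f-proper e e′ (≡-sym eq)) z∈))
              (subst (Has f′ y) (same _) h)))
            z′∉ }
        where open Split (split e ≢0 fan z∈)

      module _ {α} (α≢0 : α ≢ zero) (x-misses : ¬ Has f x α) where

        -- Of the two fan vertices missing the colour c of xz, at most one is joined to x by
        -- a (c, α)-path; switching at the other one frees α there.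
        close-cycle : ∀ {ys y z} → Fan f ys y → Edge G x z → f x z ≢ zero → z ∈ y ∷ ys →
          ¬ Has f y (f x z) → Decrease f
        close-cycle {ys} {y} {z} fan e c≢0 z∈ y-misses = by-cases (conn? x cut)
          where
          open Split (split e c≢0 fan z∈)
          c = f x z
          open Switch f-proper c α

          x-colour : ∀ {v} → ¬ Conn x v → ∀ w → switch v x w ≡ f x w
          x-colour ¬s = switch-out (¬s ∘ conn-sym)

          carries : ∀ v → Carries (switch v) z
          carries v e′ ≢c = has-switch-other v ≢c (λ eq → x-misses (_ , e′ , eq))

          switch-finish : ∀ {v zs} → ¬ Conn x v → ¬ Has f v c → Fan (switch v) zs v → Decrease f
          switch-finish {v} ¬s miss fan′ =
            decrease-via (switch-interchange ab v ◅ ε)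
              (count-≤ (λ u → has? (switch v) u zero) (λ u → has? f u zero)
                (has-switch-other v (c≢0 ∘ ≡-sym) (α≢0 ∘ ≡-sym)))
              (finish (switch-proper v) (trans (x-colour ¬s y₀) eq₀) fan′ α≢0
                (x-misses ∘ has-switch-out (¬s ∘ conn-sym))
                (miss ∘ subst (Has f v) (swap-right c α) ∘ has-switch-in ε))

          ≢x : ∀ {w} → w ∈ y ∷ ys → w ≢ x
          ≢x w∈ = edge-≢ G (fan-edge fan w∈) ∘ ≡-sym

          by-cases : Dec (Conn x cut) → Decrease f
          -- The prefix ending at `cut` does not contain `z`, so it remains a fan after the switch
          -- at `cut`.
          by-cases (no ¬s) =
            switch-finish ¬s cut-misses (transfer e prefix fresh (x-colour ¬s) (carries cut))
          -- Now `cut` is the other end of the path from `x`, so `y` lies off it. Switching at `y`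
          -- leaves `cut` missing `c`, and the whole fan survives.
          by-cases (yes s) = switch-finish ¬s y-misses
            (rebuild (x-colour ¬s)
              (cut-misses ∘ has-switch-out (λ s′ → ¬s (s ◅◅ conn-sym s′)))
              (carries y))
            where
            ¬s : ¬ Conn x y
            ¬s s′ with fan-unique fan
            ... | y∉ ∷ _ = All-lookup y∉ cut∈
              (end-unique x-misses (≢x (here refl)) (≢x (there cut∈)) s′ s
                (inj₁ y-misses) (inj₁ cut-misses))

  data Outcome (x : Fin n) (f : Coloring n (suc t)) : Set where
    decreased : Decrease f → Outcome x f
    moved : ∀ {f′ y} → KempeEquivalent G f f′ → Proper f′ → zeros f′ ≤ zeros f →
      Edge G x y → f′ x y ≡ zero → t ≤ deg G y → Outcome x f

  misses-or-full : ∀ f y → (∃ λ i → ¬ Has f y (suc i)) ⊎ (∀ i → Has f y (suc i))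
  misses-or-full f y with any? (λ i → ¬? (has? f y (suc i)))
  ... | yes miss = inj₁ miss
  ... | no none = inj₂ (λ i → decidable-stable (has? f y (suc i)) (none ∘ (i ,_)))

  -- A fan at `x` grows until its last vertex meets all nonzero colours, shares a missing colour
  -- with `x`, or misses the colour of a spoke already in the fan.
  pivot : ∀ {f x y₀} → Proper f → Edge G x y₀ → f x y₀ ≡ zero → Outcome x f
  pivot {f} {x} {y₀} f-proper e₀ eq₀ with misses-or-full f x
  -- As `x` also meets 0, meeting every nonzero colour would take `t + 1` edges.
  ... | inj₂ has = contradiction (saturated {f} {x} id id all) (<⇒≱ (s≤s (deg≤t x)))
    where
    all : ∀ c → Has f x c
    all zero = y₀ , e₀ , eq₀
    all (suc i) = has i
  ... | inj₁ (α , x-misses) = extend n base (m≤m+n n 0)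
    where
    open Fans e₀

    -- `N` is fuel: the `suc (length ys)` vertices of a fan are distinct, so it cannot run out.
    extend : ∀ N {ys y} → Fan f ys y → n ≤ N + length ys → Outcome x f
    extend zero {ys} fan le = contradiction
      (subst (suc (length ys) ≤_) (length-allFin n)
        (⊆-length-≤ (fan-unique fan) (λ {v} _ → ∈-allFin v)))
      (<⇒≱ (s≤s le))
    extend (suc N) {ys} {y} fan le with misses-or-full f y
    ... | inj₂ has = moved kempe proper zeros-≤ (fan-edge fan (here refl)) zero-at
                       (saturated {f} {y} suc suc-injective has)
      where open Shifted (shift f-proper eq₀ fan)
    ... | inj₁ (i , y-misses) with has? f x (suc i)
    ...   | no x-misses′ = decreased (finish f-proper eq₀ fan (λ ()) x-misses′ y-misses)
    ...   | yes (z , e , eq) with _∈?_ _≟_ z (y ∷ ys)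
    ...     | no z∉ = extend N (grow fan e (y-misses ∘ subst (Has f y) eq) z∉)
                        (subst (n ≤_) (≡-sym (+-suc N (length ys))) le)
    ...     | yes z∈ = decreased (close-cycle f-proper eq₀ (λ ()) x-misses fan e
                         (λ eq′ → contradiction (trans (≡-sym eq) eq′) λ ()) z∈
                         (y-misses ∘ subst (Has f y) eq))

  module _ (independent : ∀ {u v} → Edge G u v → t ≤ deg G u → t ≤ deg G v → ⊥) where

    -- If the fan at u gets stuck at a vertex y of degree t, no neighbour of y can stop a fan at y.
    remove-zero : ∀ {f u v} → Proper f → Edge G u v → f u v ≡ zero → Decrease f
    remove-zero {u = u} f-proper e eq with pivot f-proper e eq
    ... | decreased d = d
    ... | moved {y = y} k pr le e′ eq′ full
      with pivot pr (edge-sym G e′) (trans (≡-sym (proj₁ pr u y e′)) eq′)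
    ...   | decreased d = decrease-via k le d
    ...   | moved _ _ _ e″ _ full′ = contradiction full′ (independent e″ full)

    Reduced : Coloring n (suc t) → Set
    Reduced f = ∃ λ f′ → KempeEquivalent G f f′ × Proper f′ × (∀ u v → Edge G u v → f′ u v ≢ zero)

    reduce-within : ∀ N {f} → Proper f → zeros f ≤ N → Reduced f
    reduce-within N {f} f-proper le with any? (λ u → has? f u zero)
    ... | no none = f , ε , f-proper , λ u v e eq → none (u , v , e , eq)
    ... | yes (u , v , e , eq) = continue N le (remove-zero f-proper e eq)
      where
      continue : ∀ N → zeros f ≤ N → Decrease f → Reduced f
      continue zero le (decrease _ _ lt) = contradiction (≤-trans lt le) λ ()
      continue (suc N) le (decrease k pr lt) with reduce-within N pr (s≤s⁻¹ (≤-trans lt le))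
      ... | f′ , k′ , rest = f′ , k ◅◅ k′ , rest

    reduce : ∀ {f} → Proper f → Reduced f
    reduce {f} f-proper = reduce-within (zeros f) f-proper ≤-refl

-- Matchings

-- A matching is the involution exchanging matched vertices and fixing the others.
record Matching {n} (G : Graph n) : Set where
  field
    mate : Fin n → Fin n
    involutive : ∀ u → mate (mate u) ≡ u
    mate-edge : ∀ {u} → mate u ≢ u → Edge G u (mate u)

open Matching

module _ {n} (G : Graph n) (M : Matching G) where

  private
    matched-sym : ∀ u v → does (mate M u ≟ v) ≡ does (mate M v ≟ u)
    matched-sym u v with mate M u ≟ v
    ... | yes refl = ≡-sym (dec-true (mate M (mate M u) ≟ u) (involutive M u))
    ... | no ≢v = ≡-sym (dec-false (mate M v ≟ u) λ { refl → ≢v (involutive M v) })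

  _∖_ : Graph n
  _∖_ = record
    { adj = λ u v → adj G u v ∧ not (does (mate M u ≟ v))
    ; sym = λ u v → cong₂ (λ x y → x ∧ not y) (sym G u v) (matched-sym u v)
    ; irrefl = λ v → cong (_∧ not (does (mate M v ≟ v))) (irrefl G v) }

module _ {n} {G : Graph n} (M : Matching G) where

  ∖-edge⁻ : ∀ {u v} → Edge (G ∖ M) u v → Edge G u v × mate M u ≢ v
  ∖-edge⁻ {u} {v} e with adj G u v | mate M u ≟ v
  ∖-edge⁻ () | true | yes _
  ∖-edge⁻ () | false | _
  ∖-edge⁻ _ | true | no ≢v = refl , ≢v

  ∖-edge⁺ : ∀ {u v} → Edge G u v → mate M u ≢ v → Edge (G ∖ M) u v
  ∖-edge⁺ {u} {v} e ≢v with adj G u v | mate M u ≟ v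
  ∖-edge⁺ refl ≢v | .true | yes ≡v = contradiction ≡v ≢v
  ∖-edge⁺ refl ≢v | .true | no _ = refl

  ∖-deg-≤ : ∀ v → deg (G ∖ M) v ≤ deg G v
  ∖-deg-≤ v = count-≤ (edge? (G ∖ M) v) (edge? G v) (proj₁ ∘ ∖-edge⁻)

  ∖-deg-< : ∀ {v} → mate M v ≢ v → deg (G ∖ M) v < deg G v
  ∖-deg-< {v} covered = count-< (edge? (G ∖ M) v) (edge? G v) (proj₁ ∘ ∖-edge⁻)
    (mate-edge M covered) (λ e → proj₂ (∖-edge⁻ e) refl)

  deg-≤-suc-∖ : ∀ v → deg G v ≤ suc (deg (G ∖ M) v)
  deg-≤-suc-∖ v = count-≤-suc (edge? G v) (edge? (G ∖ M) v) (mate M v) cases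
    where
    cases : ∀ {w} → Edge G v w → w ≡ mate M v ⊎ Edge (G ∖ M) v w
    cases {w} e = [ inj₁ ∘ ≡-sym , inj₂ ∘ ∖-edge⁺ e ]′ (toSum (mate M v ≟ w))

-- Both ends are fixed points of `mate M`, so composing with their transposition pairs them and
-- disturbs no other pair.
add-edge : ∀ {n} {G : Graph n} (M : Matching G) {x y} → Edge G x y →
  mate M x ≡ x → mate M y ≡ y → Matching G
add-edge {n} {G} M {x} {y} xy x-free y-free = record
  { mate = swap x y ∘ mate M
  ; involutive = λ u → trans (cong (swap x y) (commute (mate M u)))
      (trans (swap-involutive x y _) (involutive M u))
  ; mate-edge = new-edge }
  where
  fixed : ∀ {z w} → mate M z ≡ z → mate M w ≡ z → w ≡ z
  fixed {w = w} z-free eq = trans (≡-sym (involutive M w)) (trans (cong (mate M) eq) z-free)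

  commute : ∀ w → mate M (swap x y w) ≡ swap x y (mate M w)
  commute w with w ≟ x
  ... | yes refl rewrite x-free = trans y-free (≡-sym (swap-left x y))
  ... | no w≢x with w ≟ y
  ...   | yes refl rewrite y-free = trans x-free (≡-sym (swap-right x y))
  ...   | no w≢y = ≡-sym (swap-other (w≢x ∘ fixed x-free) (w≢y ∘ fixed y-free))

  new-edge : ∀ {w} → swap x y (mate M w) ≢ w → Edge G w (swap x y (mate M w))
  new-edge {w} moved with mate M w ≟ x
  ... | yes eq rewrite fixed x-free eq = xy
  ... | no _ with mate M w ≟ y
  ...   | yes eq rewrite fixed y-free eq = edge-sym G xy
  ...   | no _ = mate-edge M moved

module _ {n} (G : Graph n) where

  MaximalAt : Matching G → Fin n → Set
  MaximalAt M u = ∀ v → Edge G u v → mate M u ≡ u → mate M v ≢ v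

  -- Greedy choice: a free `u` is matched with a free neighbour if there is one. Adding an edge
  -- frees no vertex, so maximality at the earlier vertices persists.
  maximal-on : ∀ us → Σ (Matching G) λ M → ∀ {u} → u ∈ us → MaximalAt M u
  maximal-on [] = record { mate = id ; involutive = λ _ → refl
                         ; mate-edge = λ ≢u → contradiction refl ≢u } , λ ()
  maximal-on (u ∷ us) with maximal-on us
  ... | M , max with mate M u ≟ u
  ...   | no covered = M , λ { (here refl) _ _ free → contradiction free covered
                             ; (there u∈) → max u∈ }
  ...   | yes u-free with any? (λ v → edge? G u v ×-dec (mate M v ≟ v))
  ...     | no none = M , λ { (here refl) v e _ v-free → none (v , e , v-free)
                            ; (there u∈) → max u∈ }
  ...     | yes (v , e , v-free) = add-edge M e u-free v-free ,
            λ { (here refl) _ _ free → contradiction free u-covered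
              ; (there u∈) w e′ free w-free → max u∈ w e′ (still-free free) (still-free w-free) }
    where
    u-covered : swap u v (mate M u) ≢ u
    u-covered eq = edge-≢ G e (trans (≡-sym eq) (trans (cong (swap u v) u-free) (swap-left u v)))

    still-free : ∀ {w} → swap u v (mate M w) ≡ w → mate M w ≡ w
    still-free {w} eq with w ≟ u | w ≟ v
    ... | yes refl | _ = u-free
    ... | _ | yes refl = v-free
    ... | no w≢u | no w≢v = trans (≡-sym (swap-involutive u v (mate M w)))
                              (trans (cong (swap u v) eq) (swap-other w≢u w≢v))

  maximal-matching : Σ (Matching G) λ M → ∀ u → MaximalAt M u
  maximal-matching with maximal-on (allFin n)
  ... | M , max = M , λ u → max (∈-allFin u)

-- A colour class as a matching

module ColourClass {n} (G : Graph n) {s} {h : Coloring n (suc s)} (h-proper : IsProperColoring G h) where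

  open Kempe G (suc s)

  partner : Fin n → Fin n
  partner u with has? h u zero
  ... | yes (w , _) = w
  ... | no _ = u

  partner-≡ : ∀ {u w} → Edge G u w → h u w ≡ zero → partner u ≡ w
  partner-≡ {u} {w} e eq with has? h u zero
  ... | yes (w′ , e′ , eq′) = same-end h-proper e′ e (trans eq′ (≡-sym eq))
  ... | no none = contradiction (w , e , eq) none

  class-matching : Matching G
  class-matching = record
    { mate = partner ; involutive = partner-involutive ; mate-edge = partner-edge }
    where
    partner-involutive : ∀ u → partner (partner u) ≡ u
    partner-involutive u with has? h u zero in eq
    ... | yes (w , e , z) = partner-≡ (edge-sym G e) (trans (≡-sym (proj₁ h-proper u w e)) z)
    ... | no _ rewrite eq = refl

    partner-edge : ∀ {u} → partner u ≢ u → Edge G u (partner u)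
    partner-edge {u} ≢u with has? h u zero
    ... | yes (_ , e , _) = e
    ... | no _ = contradiction refl ≢u

  class-covers : ∀ {u} → Has h u zero → partner u ≢ u
  class-covers (w , e , z) eq = edge-≢ G e (trans (≡-sym eq) (partner-≡ e z))

  deg-avoiding-zero : ∀ {v} → ¬ Has h v zero → deg G v ≤ s
  deg-avoiding-zero {v} none = subst (deg G v ≤_) (trans (length-map suc (allFin s)) (length-allFin s))
    (image-length-≤ (h v) (counted-unique (edge? G v)) nonzero
      (λ x∈ y∈ → same-end h-proper (counted⁻ (edge? G v) x∈) (counted⁻ (edge? G v) y∈)))
    where
    nonzero : ∀ {w} → w ∈ counted (edge? G v) → h v w ∈ map suc (allFin s)
    nonzero {w} w∈ with h v w in eq
    ... | zero = contradiction (w , counted⁻ (edge? G v) w∈ , eq) none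
    ... | suc i = ∈-map⁺ suc (∈-allFin i)

-- Dropping a colour, and adding a matching as a new colour class

lower : ∀ {n t} → Fin t → Coloring n (suc t) → Coloring n t
lower d f u v with f u v
-- A placeholder: no edge of the graph to be coloured by `lower` has colour 0.
... | zero = d
... | suc i = i

suc-lower : ∀ {n t} d (f : Coloring n (suc t)) {u v} → f u v ≢ zero → suc (lower d f u v) ≡ f u v
suc-lower d f {u} {v} ≢0 with f u v
... | zero = contradiction refl ≢0
... | suc i = refl

lower-proper : ∀ {n t} (G H : Graph n) d {f : Coloring n (suc t)} → IsProperColoring G f →
  (∀ {u v} → Edge H u v → Edge G u v) → (∀ u v → Edge H u v → f u v ≢ zero) →
  IsProperColoring H (lower d f)
lower-proper G H d {f} (f-sym , f-dist) sub ≢0 =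
  (λ u v e → suc-injective (trans (suc-lower d f (≢0 u v e))
    (trans (f-sym u v (sub e)) (≡-sym (suc-lower d f (≢0 v u (edge-sym H e))))))) ,
  (λ u v w e e′ v≢w eq → f-dist u v w (sub e) (sub e′) v≢w
    (trans (≡-sym (suc-lower d f (≢0 u v e))) (trans (cong suc eq) (suc-lower d f (≢0 u w e′)))))

module Lift {n} {G : Graph n} (M : Matching G) {t : ℕ} where

  lift : Coloring n t → Coloring n (suc t)
  lift c u v with mate M u ≟ v
  ... | yes _ = zero
  ... | no _ = suc (c u v)

  lift-yes : ∀ c {u v} → mate M u ≡ v → lift c u v ≡ zero
  lift-yes c {u} {v} eq with mate M u ≟ v
  ... | yes _ = refl
  ... | no ≢v = contradiction eq ≢v

  lift-no : ∀ c {u v} → mate M u ≢ v → lift c u v ≡ suc (c u v)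
  lift-no c {u} {v} ≢v with mate M u ≟ v
  ... | yes eq = contradiction eq ≢v
  ... | no _ = refl

  mate-flip : ∀ {u v} → mate M u ≡ v → mate M v ≡ u
  mate-flip refl = involutive M _

  lift-proper : ∀ {c} → IsProperColoring (G ∖ M) c → IsProperColoring G (lift c)
  lift-proper {c} (c-sym , c-dist) = symmetric , distinct
    where
    symmetric : ∀ u v → Edge G u v → lift c u v ≡ lift c v u
    symmetric u v e with mate M u ≟ v
    ... | yes eq = ≡-sym (lift-yes c (mate-flip eq))
    ... | no ≢v = trans (cong suc (c-sym u v (∖-edge⁺ M e ≢v))) (≡-sym (lift-no c (≢v ∘ mate-flip)))

    distinct : ∀ u v w → Edge G u v → Edge G u w → v ≢ w → lift c u v ≢ lift c u w
    distinct u v w e e′ v≢w eq with mate M u ≟ v | mate M u ≟ w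
    ... | yes p | yes q = v≢w (trans (≡-sym p) q)
    ... | no p | no q = c-dist u v w (∖-edge⁺ M e p) (∖-edge⁺ M e′ q) v≢w (suc-injective eq)
    distinct u v w e e′ v≢w () | yes _ | no _
    distinct u v w e e′ v≢w () | no _ | yes _

  -- The edges of `M` have colour 0, which is neither `suc a` nor `suc b`, so the components in G
  -- and in G - M are the same.
  lift-interchange : ∀ {c c′} → Interchange (G ∖ M) c c′ → Interchange G (lift c) (lift c′)
  lift-interchange {c} {c′} (a , b , (u₀ , v₀) , ab₀ , h) =
    suc a , suc b , (u₀ , v₀) , raise ab₀ , λ u v e → on-component u v e , off-component u v e
    where
    raise : ∀ {e} → IsABEdge (G ∖ M) c a b e → IsABEdge G (lift c) (suc a) (suc b) e
    raise {u , v} (e , ab) with ∖-edge⁻ M e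
    ... | e′ , ≢v = e′ , subst (λ x → x ≡ suc a ⊎ x ≡ suc b) (≡-sym (lift-no c ≢v))
                           (map-⊎ (cong suc) (cong suc) ab)

    unraise : ∀ {e} → IsABEdge G (lift c) (suc a) (suc b) e → IsABEdge (G ∖ M) c a b e
    unraise {u , v} (e , ab) = from (mate M u ≟ v)
      where
      from : Dec (mate M u ≡ v) → IsABEdge (G ∖ M) c a b (u , v)
      from (yes eq) = contradiction
        (subst (λ x → x ≡ suc a ⊎ x ≡ suc b) (lift-yes c eq) ab) [ (λ ()) , (λ ()) ]′
      from (no ≢v) = ∖-edge⁺ M e ≢v , map-⊎ suc-injective suc-injective
        (subst (λ x → x ≡ suc a ⊎ x ≡ suc b) (lift-no c ≢v) ab)

    up : ∀ {e e′} → Star (ABStep (G ∖ M) c a b) e e′ → Star (ABStep G (lift c) (suc a) (suc b)) e e′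
    up = gmap id (λ { (x , y , z) → raise x , raise y , z })

    down : ∀ {e e′} → Star (ABStep G (lift c) (suc a) (suc b)) e e′ → Star (ABStep (G ∖ M) c a b) e e′
    down = gmap id (λ { (x , y , z) → unraise x , unraise y , z })

    on-component : ∀ u v → Edge G u v → Star (ABStep G (lift c) (suc a) (suc b)) (u₀ , v₀) (u , v) →
      lift c′ u v ≡ swap (suc a) (suc b) (lift c u v)
    on-component u v e s with mate M u ≟ v
    ... | yes _ = refl
    ... | no ≢v = trans (cong suc (proj₁ (h u v (∖-edge⁺ M e ≢v)) (down s)))
                        (≡-sym (swap-suc a b (c u v)))

    off-component : ∀ u v → Edge G u v → ¬ Star (ABStep G (lift c) (suc a) (suc b)) (u₀ , v₀) (u , v) →
      lift c′ u v ≡ lift c u v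
    off-component u v e ¬s with mate M u ≟ v
    ... | yes _ = refl
    ... | no ≢v = cong suc (proj₂ (h u v (∖-edge⁺ M e ≢v)) (¬s ∘ up))

  lift-kempe : ∀ {c c′} → KempeEquivalent (G ∖ M) c c′ → KempeEquivalent G (lift c) (lift c′)
  lift-kempe = gmap lift lift-interchange

∖-colorable : ∀ {n} {G : Graph n} (M : Matching G) {t} → Colorable (G ∖ M) t → Colorable G (suc t)
∖-colorable M (c , c-proper) = Lift.lift M c , Lift.lift-proper M c-proper

-- Recolouring a matching with a free colour

module Paint {n} (G : Graph n) (M : Matching G) (t : ℕ) {a b} (ab : Edge G a b) where

  open Kempe G (suc t)

  Inside : Coloring n (suc t) → Set
  Inside f = ∀ u v → Edge G u v → f u v ≡ zero → mate M u ≡ v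

  Painted : Coloring n (suc t) → Fin n → Set
  Painted f u = mate M u ≢ u → f u (mate M u) ≡ zero

  record PaintedOn (f : Coloring n (suc t)) (S : Fin n → Set) : Set where
    field
      result : Coloring n (suc t)
      kempe : KempeEquivalent G f result
      proper : Proper result
      inside : Inside result
      painted : ∀ {u} → S u → Painted result u

  -- By `Inside`, no edge at `u` or its mate other than the matching edge can have colour 0. If that
  -- edge has a colour `c` other than 0, it is a (0, c)-component by itself, and switching paints
  -- it.
  paint-at : ∀ {f} → Proper f → Inside f → ∀ u → PaintedOn f (λ w → w ≡ u ⊎ Painted f w)
  paint-at {f} f-proper f-inside u with mate M u ≟ u
  ... | yes free = record
    { result = f ; kempe = ε ; proper = f-proper ; inside = f-inside
    ; painted = λ { (inj₁ refl) ≢u → contradiction free ≢u ; (inj₂ p) → p } }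
  ... | no covered with f u (mate M u) ≟ zero
  ...   | yes eq = record
    { result = f ; kempe = ε ; proper = f-proper ; inside = f-inside
    ; painted = λ { (inj₁ refl) _ → eq ; (inj₂ p) → p } }
  ...   | no c≢0 = record
    { result = switch u
    ; kempe = switch-interchange ab u ◅ ε
    ; proper = switch-proper u
    ; inside = inside
    ; painted = λ { (inj₁ refl) _ → trans (switch-in ε v) (swap-right zero c)
                  ; (inj₂ p) → preserved p } }
    where
    v = mate M u
    c = f u v
    open Switch f-proper zero c

    uv : Edge G u v
    uv = mate-edge M covered

    vu-colour : f v u ≡ c
    vu-colour = ≡-sym (proj₁ f-proper u v uv)

    Pair : Fin n → Set
    Pair w = w ≡ u ⊎ w ≡ v

    pair-step : ∀ {x w} → Pair x → PQ x w → Pair w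
    pair-step (inj₁ refl) (e , inj₁ z) = inj₂ (≡-sym (f-inside _ _ e z))
    pair-step (inj₁ refl) (e , inj₂ eq) = inj₂ (same-end f-proper e uv eq)
    pair-step (inj₂ refl) (e , inj₁ z) =
      inj₁ (trans (≡-sym (f-inside _ _ e z)) (involutive M u))
    pair-step (inj₂ refl) (e , inj₂ eq) =
      inj₁ (same-end f-proper e (edge-sym G uv) (trans eq (≡-sym vu-colour)))

    conn-pair : ∀ {x w} → Pair x → Conn x w → Pair w
    conn-pair p ε = p
    conn-pair p (pq ◅ s) = conn-pair (pair-step p pq) s

    pair-mate : ∀ {w z} → Pair w → Edge G w z → f w z ≡ c → mate M w ≡ z
    pair-mate (inj₁ refl) e eq = same-end f-proper uv e (≡-sym eq)
    pair-mate (inj₂ refl) e eq = trans (involutive M u)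
      (same-end f-proper (edge-sym G uv) e (trans vu-colour (≡-sym eq)))

    inside : Inside (switch u)
    inside w z e eq with conn? u w
    ... | yes s = pair-mate (conn-pair (inj₁ refl) s) e
                    (swap-injective (trans eq (≡-sym (swap-right zero c))))
    ... | no _ = f-inside w z e eq

    preserved : ∀ {w} → Painted f w → Painted (switch u) w
    preserved {w} p w-covered with conn? u w
    ... | no _ = p w-covered
    ... | yes s with conn-pair (inj₁ refl) s
    ...   | inj₁ refl = contradiction (p w-covered) c≢0
    ...   | inj₂ refl = contradiction
              (trans (≡-sym vu-colour) (trans (cong (f v) (≡-sym (involutive M u))) (p w-covered)))
              c≢0

  paint : ∀ {f} → Proper f → Inside f → ∀ us → PaintedOn f (_∈ us)
  paint {f} f-proper f-inside [] = record
    { result = f ; kempe = ε ; proper = f-proper ; inside = f-inside ; painted = λ () }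
  paint f-proper f-inside (u ∷ us) = record
    { result = U.result ; kempe = T.kempe ◅◅ U.kempe ; proper = U.proper ; inside = U.inside
    ; painted = λ { (here eq) → U.painted (inj₁ eq)
                ; (there u∈) → U.painted (inj₂ (T.painted u∈)) } }
    where
    module T = PaintedOn (paint f-proper f-inside us)
    module U = PaintedOn (paint-at T.proper T.inside u)

-- Transferring Kempe equivalence from G - M to G

module _ {n} (G : Graph n) {t} {a b} (ab : Edge G a b) (deg≤t : ∀ v → deg G v ≤ t)
  (independent : ∀ {u v} → Edge G u v → t ≤ deg G u → t ≤ deg G v → ⊥)
  (M : Matching G) (d : Fin t) where

  open Kempe G (suc t)
  open Lift M {t}

  record Lowered (f : Coloring n (suc t)) : Set where
    field
      lowered : Coloring n t
      proper : IsProperColoring (G ∖ M) lowered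
      kempe : KempeEquivalent G f (lift lowered)

  -- Colour 0 is eliminated and then painted on all of `M`; what results agrees on edges with the
  -- lift of its own restriction to G - M.
  lowered : ∀ {f} → Proper f → Lowered f
  lowered f-proper
    with Reduction.reduce G t ab deg≤t (λ {u} {v} → independent {u} {v}) f-proper
  ... | f′ , k , f′-proper , nonzero = record
    { lowered = lower d result
    ; proper = lower-proper G (G ∖ M) d proper (proj₁ ∘ ∖-edge⁻ M) off-M
    ; kempe = k ◅◅ kempe ◅◅ ≈⇒interchange ab lift-lower ◅ ε }
    where
    open Paint G M t ab
    open PaintedOn (paint f′-proper (λ u v e z → contradiction z (nonzero u v e)) (allFin n))

    off-M : ∀ u v → Edge (G ∖ M) u v → result u v ≢ zero
    off-M u v e z with ∖-edge⁻ M e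
    ... | e′ , ≢v = ≢v (inside u v e′ z)

    lift-lower : result ≈ lift (lower d result)
    lift-lower u v e with mate M u ≟ v
    ... | yes refl = painted (∈-allFin u) (edge-≢ G e ∘ ≡-sym)
    ... | no ≢v = ≡-sym (suc-lower d result (≢v ∘ inside u v e))

  allKempe-∖ : AllKempeEquivalent (G ∖ M) t → AllKempeEquivalent G (suc t)
  allKempe-∖ all f g f-proper g-proper =
    F.kempe ◅◅ lift-kempe (all F.lowered G′.lowered F.proper G′.proper) ◅◅ kempe-sym G′.kempe
    where
    module F = Lowered (lowered f-proper)
    module G′ = Lowered (lowered g-proper)

-- Maximum degree

private
  max : List ℕ → ℕ
  max = foldr _⊔_ 0

module _ {A : Set} (d : A → ℕ) where

  ≤-max : ∀ {x xs} → x ∈ xs → d x ≤ max (map d xs)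
  ≤-max {xs = y ∷ ys} (here refl) = m≤m⊔n (d y) _
  ≤-max {xs = y ∷ ys} (there x∈) = ≤-trans (≤-max x∈) (m≤n⊔m (d y) _)

  max-≤ : ∀ {b} xs → (∀ x → d x ≤ b) → max (map d xs) ≤ b
  max-≤ [] d≤ = z≤n
  max-≤ (x ∷ xs) d≤ = ⊔-lub (d≤ x) (max-≤ xs d≤)

  max-attained : ∀ {m} xs → max (map d xs) ≡ suc m → ∃ λ x → d x ≡ suc m
  max-attained (x ∷ xs) eq with ⊔-sel (d x) (max (map d xs))
  ... | inj₁ left = x , trans (≡-sym left) eq
  ... | inj₂ right = max-attained xs (trans (≡-sym right) eq)

module _ {n} (G : Graph n) where

  deg-≤-Δ : ∀ v → deg G v ≤ Δ G
  deg-≤-Δ v = ≤-max (deg G) (∈-allFin v)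

  Δ-≡ : ∀ {d v} → (∀ v → deg G v ≤ d) → d ≤ deg G v → Δ G ≡ d
  Δ-≡ {v = v} deg≤ d≤ = ≤-antisym (max-≤ (deg G) (allFin n) deg≤) (≤-trans d≤ (deg-≤-Δ v))

  deg>0⇒edge : ∀ {v m} → suc m ≤ deg G v → ∃ λ w → Edge G v w
  deg>0⇒edge {v} lt with counted (edge? G v) in eq
  deg>0⇒edge () | []
  ... | w ∷ ws = w , counted⁻ (edge? G v) (subst (w ∈_) (≡-sym eq) (here refl))

-- The graphs left by a maximal matching and by a colour class, with k = s + 2

module Main (s : ℕ)
  (hyp : ∀ (m : ℕ) (H : Graph m) → Δ H ≡ suc s →
    ∀ χ → IsChromaticIndex H χ → AllKempeEquivalent H (χ + 1))
  {n} (G : Graph n) (class2 : Class2 G) (Δ≡ : Δ G ≡ suc (suc s))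
  (M : Matching G) (maximal : ∀ u → MaximalAt G M u) where

  k : ℕ
  k = suc (suc s)

  -- G is Class 2 with maximum degree `k`. This is the source of the lower bounds on the chromatic
  -- indices of `H` and `H′`.
  needs : ∀ {t} → Colorable G t → k < t
  needs {t} c = subst (_≤ t) (trans (cong (_+ 1) Δ≡) (+-comm k 1)) (proj₂ class2 t c)

  deg≤k : ∀ v → deg G v ≤ k
  deg≤k v = subst (deg G v ≤_) Δ≡ (deg-≤-Δ G v)

  top : ∃ λ v → deg G v ≡ k
  top = max-attained (deg G) (allFin n) Δ≡

  v₀ : Fin n
  v₀ = proj₁ top

  k≤v₀ : k ≤ deg G v₀
  k≤v₀ = ≤-reflexive (≡-sym (proj₂ top))

  G-edge : ∃ λ w → Edge G v₀ w
  G-edge = deg>0⇒edge G k≤v₀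

  H : Graph n
  H = G ∖ M

  H-deg≤k : ∀ v → deg H v ≤ k
  H-deg≤k v = ≤-trans (∖-deg-≤ M v) (deg≤k v)

  H-v₀ : suc s ≤ deg H v₀
  H-v₀ = s≤s⁻¹ (≤-trans k≤v₀ (deg-≤-suc-∖ M v₀))

  H-edge : ∃ λ w → Edge H v₀ w
  H-edge = deg>0⇒edge H H-v₀

  full-free : ∀ {v} → k ≤ deg H v → mate M v ≡ v
  full-free {v} full = decidable-stable (mate M v ≟ v)
    (λ covered → <⇒≱ (<-≤-trans (∖-deg-< M covered) (deg≤k v)) full)

  -- A vertex of degree `k` in `H` is unmatched, and a maximal matching leaves no two adjacent
  -- vertices unmatched.
  H-independent : ∀ {u v} → Edge H u v → k ≤ deg H u → k ≤ deg H v → ⊥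
  H-independent {u} {v} e fu fv = maximal u v (proj₁ (∖-edge⁻ M e))
    (full-free fu) (full-free fv)

  -- Fournier's theorem for H, whose vertices of degree k are independent.
  H-colorable : Colorable H k
  H-colorable with subst (Colorable G) (trans (cong (_+ 1) Δ≡) (+-comm k 1)) (proj₁ class2)
  ... | c , c-sym , c-dist
    with Reduction.reduce H k (proj₂ H-edge) H-deg≤k (λ {u} {v} → H-independent {u} {v})
           {f = c} ((λ u v e → c-sym u v (proj₁ (∖-edge⁻ M e))) ,
                    (λ u v w e e′ → c-dist u v w (proj₁ (∖-edge⁻ M e)) (proj₁ (∖-edge⁻ M e′))))
  ...   | f , _ , f-proper , nonzero = lower zero f , lower-proper H H zero f-proper id nonzero

  all-by-hyp : ∀ (K : Graph n) → Δ K ≡ suc s → ∀ χ → IsChromaticIndex K χ →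
    AllKempeEquivalent K (suc χ)
  all-by-hyp K ΔK χ index = subst (AllKempeEquivalent K) (+-comm χ 1) (hyp n K ΔK χ index)

  module _ {h : Coloring n k} (h-proper : IsProperColoring H h) where

    open ColourClass H h-proper

    H′ : Graph n
    H′ = H ∖ class-matching

    -- A vertex meeting colour 0 loses an edge; any other has at most as many edges in `H` as there
    -- are nonzero colours, namely `suc s`.
    H′-deg≤ : ∀ v → deg H′ v ≤ suc s
    H′-deg≤ v = [ (λ has → s≤s⁻¹ (<-≤-trans (∖-deg-< class-matching (class-covers has)) (H-deg≤k v)))
                , ≤-trans (∖-deg-≤ class-matching v) ∘ deg-avoiding-zero
                ]′ (toSum (Kempe.has? H k h v zero))

    H′-colorable : Colorable H′ (suc s)
    H′-colorable = lower zero h , lower-proper H H′ zero h-proper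
      (proj₁ ∘ ∖-edge⁻ class-matching)
      λ u v e z → proj₂ (∖-edge⁻ class-matching e) (partner-≡ (proj₁ (∖-edge⁻ class-matching e)) z)

    all-H : AllKempeEquivalent H (suc k)
    all-H with any? (λ v → k ≤? deg H v)
    -- The chromatic index of `H` is `k`: a colouring with fewer colours, together with `M` as one
    -- more class, would colour G with at most `k`.
    ... | no none = all-by-hyp H (Δ-≡ H (λ v → s≤s⁻¹ (≰⇒> (none ∘ (v ,_)))) H-v₀) k
            ((h , h-proper) , λ t c → s≤s⁻¹ (needs (∖-colorable M c)))
    -- The vertex `v` loses at most one edge, so `H′` has maximum degree `suc s`. Restoring two
    -- matchings costs two colours, so its chromatic index is at least `suc s` too.
    ... | yes (v , full) = allKempe-∖ H (proj₂ H-edge) H-deg≤k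
            (λ {u} {v} → H-independent {u} {v}) class-matching zero
            (all-by-hyp H′
              (Δ-≡ H′ H′-deg≤ (s≤s⁻¹ (≤-trans full (deg-≤-suc-∖ class-matching v))))
              (suc s)
              (H′-colorable ,
               λ t c → s≤s⁻¹ (s≤s⁻¹ (needs (∖-colorable M (∖-colorable class-matching c))))))

  all-G : AllKempeEquivalent G (suc (suc k))
  all-G = allKempe-∖ G (proj₂ G-edge) (λ v → ≤-trans (deg≤k v) (n≤1+n k))
    -- The elimination runs with `t = k + 1`; no vertex has that degree, so independence is vacuous.
    (λ {u} _ full _ → <⇒≱ (s≤s (deg≤k u)) full) M zero (all-H (proj₂ H-colorable))

theorem1p2 : (k : ℕ) → 4 ≤ k →
    (∀ (m : ℕ) (H : Graph m) → Δ H ≡ k ∸ 1 →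
    ∀ χ → IsChromaticIndex H χ → AllKempeEquivalent H (χ + 1)) →
    ∀ (n : ℕ) (G : Graph n) → Class2 G → Δ G ≡ k →
    AllKempeEquivalent G (k + 2)
theorem1p2 (suc zero) (s≤s ())
theorem1p2 k@(suc (suc s)) _ hyp n G class2 Δ≡ =
  subst (AllKempeEquivalent G) (+-comm 2 k) (Main.all-G s hyp G class2 Δ≡ M maximal)
  where
  M = proj₁ (maximal-matching G)
  maximal = proj₂ (maximal-matching G)
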